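{- Let $k\geq 2$ be an integer. For any graph $G$ of order $n$ with minimum degree $\delta(G)\geq k-1$, \[ 2k\leq \gamma_{\times kR}(G)\leq 2n, \] and $\gamma_{\times kR}(G)=2k$ if and only if $G=K_k$ or $G=H\circ_k K_k$ for some graph $H$ (equality of graphs meaning isomorphism).
   Context: All graphs are finite, undirected and simple; the order of a graph is its number of vertices. For an integer $k\geq 1$ and a graph $G=(V,E)$ with minimum degree at least $k-1$, a Roman $k$-tuple dominating function (R$k$DF) on $G$ is a function $f\colon V\to\{0,1,2\}$ such that every vertex $v$ with $f(v)=0$ has at least $k$ neighbors $w$ with $f(w)=2$, and every vertex $v$ with $f(v)\neq 0$ has at least $k-1$ neighbors $w$ with $f(w)=2$. The weight of $f$ is $f(V)=\sum_{v\in V}f(v)$, and the Roman $k$-tuple domination number $\gamma_{\times kR}(G)$ is the minimum weight of an R$k$DF on $G$. $K_k$ is the complete graph of order $k$. For an integer $k\geq 1$, a $k$-join $G\circ_k H$ of a graph $G$ to a graph $H$ of order at least $k$ is a graph obtained from the disjoint union of $G$ and $H$ by joining each vertex of $G$ to at least $k$ vertices of $H$. -}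

module Defs where

open import Level using (0ℓ)
open import Data.Nat.Base using (ℕ; _+_; _∸_; _^_; _≤_)
open import Data.Nat.ListAction using (sum)
open import Data.Nat.Properties using (_≤?_)
open import Data.Fin.Base using (Fin; toℕ; splitAt; finToFun)
open import Data.Fin.Patterns using (0F; 2F)
open import Data.Fin.Properties using (_≟_; all?)
open import Data.Fin.Subset using (Subset; _∈_; _∩_; ∣_∣)
open import Data.Fin.Subset.Properties using (_∈?_)
open import Data.List.Base as List using (List; []; _∷_)
open import Data.List.Extrema.Nat using (min)
import Data.Vec.Base as Vec
open import Data.Product.Base using (_×_; Σ-syntax; ∃-syntax)
open import Data.Sum.Base using (_⊎_; inj₁; inj₂)
open import Function.Base using (_∘_)
open import Function.Bundles using (_⇔_; _↔_; Inverse)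
open import Relation.Binary.Core using (Rel)
open import Relation.Binary.Definitions using (Decidable; Symmetric; Irreflexive)
open import Relation.Binary.PropositionalEquality using (_≡_; _≢_; ≢-sym)
open import Relation.Nullary.Decidable using (does; ¬?; _×-dec_; _→-dec_)
open import Relation.Unary using (Pred) renaming (Decidable to Decidable₁)

-- The value 0 at [] is a junk value.
minimum : List ℕ → ℕ
minimum []       = 0
minimum (x ∷ xs) = min x xs

toSubset : ∀ {n} {P : Pred (Fin n) 0ℓ} → Decidable₁ P → Subset n
toSubset P? = Vec.tabulate (does ∘ P?)

record Graph (n : ℕ) : Set₁ where
  field
    _~_    : Rel (Fin n) 0ℓ
    _~?_   : Decidable _~_
    sym    : Symmetric _~_
    irrefl : Irreflexive _≡_ _~_

  neighbors : Fin n → Subset n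
  neighbors v = toSubset (v ~?_)

  degree : Fin n → ℕ
  degree v = ∣ neighbors v ∣

  -- This is 0 for the graph without vertices, so a positive lower bound on
  -- δ forces the graph to be nonempty.
  δ : ℕ
  δ = minimum (List.tabulate degree)

infix 4 _≅_

_≅_ : ∀ {m n} → Graph m → Graph n → Set
_≅_ {m} {n} G H =
  Σ[ φ ∈ (Fin m ↔ Fin n) ]
    (∀ u v → (u G.~ v) ⇔ (Inverse.to φ u H.~ Inverse.to φ v))
  where
  module G = Graph G
  module H = Graph H

K : ∀ n → Graph n
K n = record
  { _~_    = _≢_
  ; _~?_   = λ u v → ¬? (u ≟ v)
  ; sym    = ≢-sym
  ; irrefl = λ u≡v u≢v → u≢v u≡v
  }

-- The disjoint union of G and H, together with edges joining each vertex u
-- of G to the vertices of H in C u.  Fin (m + n) is split into Fin m ⊎ Fin n.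
module _ {m n : ℕ} (G : Graph m) (H : Graph n) (C : Fin m → Subset n) where
  private
    module G = Graph G
    module H = Graph H

  JoinAdj : Rel (Fin m ⊎ Fin n) 0ℓ
  JoinAdj (inj₁ u) (inj₁ v) = u G.~ v
  JoinAdj (inj₁ u) (inj₂ w) = w ∈ C u
  JoinAdj (inj₂ w) (inj₁ u) = w ∈ C u
  JoinAdj (inj₂ w) (inj₂ x) = w H.~ x

  joinAdj? : Decidable JoinAdj
  joinAdj? (inj₁ u) (inj₁ v) = u G.~? v
  joinAdj? (inj₁ u) (inj₂ w) = w ∈? C u
  joinAdj? (inj₂ w) (inj₁ u) = w ∈? C u
  joinAdj? (inj₂ w) (inj₂ x) = w H.~? x

  joinAdj-sym : ∀ a b → JoinAdj a b → JoinAdj b a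
  joinAdj-sym (inj₁ _) (inj₁ _) p = G.sym p
  joinAdj-sym (inj₁ _) (inj₂ _) p = p
  joinAdj-sym (inj₂ _) (inj₁ _) p = p
  joinAdj-sym (inj₂ _) (inj₂ _) p = H.sym p

  joinAdj-irrefl : Irreflexive _≡_ JoinAdj
  joinAdj-irrefl {inj₁ _} _≡_.refl = G.irrefl _≡_.refl
  joinAdj-irrefl {inj₂ _} _≡_.refl = H.irrefl _≡_.refl

  join : Graph (m + n)
  join = record
    { _~_    = λ a b → JoinAdj (splitAt m a) (splitAt m b)
    ; _~?_   = λ a b → joinAdj? (splitAt m a) (splitAt m b)
    ; sym    = λ {a} {b} → joinAdj-sym (splitAt m a) (splitAt m b)
    ; irrefl = λ { {a} _≡_.refl → joinAdj-irrefl {splitAt m a} _≡_.refl }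
    }

-- J ≅ G ∘[ k ] H : J is, up to isomorphism, a k-join of G to H.
infix 4 _≅_∘[_]_

_≅_∘[_]_ : ∀ {p m n} → Graph p → Graph m → ℕ → Graph n → Set
_≅_∘[_]_ {m = m} {n} J G k H =
  k ≤ n ×
  ∃[ C ] (∀ (u : Fin m) → k ≤ ∣ C u ∣) × J ≅ join G H C

Labelling : ℕ → Set
Labelling n = Fin n → Fin 3

allLabellings : ∀ n → List (Labelling n)
allLabellings n = List.map finToFun (List.allFin (3 ^ n))

weight : ∀ {n} → Labelling n → ℕ
weight f = sum (List.tabulate (toℕ ∘ f))

V₂ : ∀ {n} → Labelling n → Subset n
V₂ f = toSubset (λ w → f w ≟ 2F)

module _ {n : ℕ} (k : ℕ) (G : Graph n) where
  open Graph G

  IsRkDF : Pred (Labelling n) 0ℓ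
  IsRkDF f = ∀ v →
    (f v ≡ 0F → k ≤ ∣ neighbors v ∩ V₂ f ∣) ×
    (f v ≢ 0F → k ∸ 1 ≤ ∣ neighbors v ∩ V₂ f ∣)

  isRkDF? : Decidable₁ IsRkDF
  isRkDF? f = all? λ v →
    ((f v ≟ 0F) →-dec (k ≤? ∣ neighbors v ∩ V₂ f ∣)) ×-dec
    (¬? (f v ≟ 0F) →-dec (k ∸ 1 ≤? ∣ neighbors v ∩ V₂ f ∣))

  -- This is a junk value unless k ∸ 1 ≤ δ, in which case the constant
  -- labelling 2 shows that the minimum is over a nonempty list.
  γ×R : ℕ
  γ×R = minimum (List.map weight (List.filter isRkDF? (allLabellings n)))

{-# OPTIONS --safe #-}

-- For an RkDF f, a vertex of V₂ f has at least k ∸ 1 neighbours in V₂ f other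
-- than itself, so V₂ f has at least k elements and f has weight at least 2k.
-- If the weight is exactly 2k, then f takes only the values 0 and 2 and V₂ f
-- has k elements, so every vertex must be adjacent to all the other elements
-- of V₂ f: V₂ f is a copy of K k joined completely to the rest.  Conversely, a
-- set of k vertices, each adjacent to all other vertices, gives an RkDF of
-- weight 2k.

module Submission where

open import Defs
open import Data.Bool.Base using (if_then_else_)
open import Data.Fin.Base using (Fin; zero; suc; toℕ; finToFun; funToFin)
open import Data.Fin.Patterns using (0F; 1F; 2F)
open import Data.Fin.Properties
  using (_≟_; +↔⊎; splitAt-join; injective⇒≤; finToFun-funToFin)
open import Data.Fin.Subset
  using (Subset; inside; outside; _∈_; _∉_; _⊆_; _∩_; _-_; ∁; ⊤; ∣_∣; Nonempty)
open import Data.Fin.Subset.Properties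
  using ( _∈?_; ∈⊤; ∣⊥∣≡0; ∣⊤∣≡n; ∣p∣≤n; ∣p∣≡n⇒p≡⊤; ∩-identityʳ; Empty-unique
        ; nonempty?; p⊆q⇒∣p∣≤∣q∣; p⊂q⇒∣p∣<∣q∣; p─⊥≡p; p─q⊆p; x∈p∩q⁺; x∈p∩q⁻; x∉p⇒x∈∁p
        ; ∣∁p∣≡n∸∣p∣; x∈p∧x≢y⇒x∈p-y; x∈p⇒∣p-x∣<∣p∣; ∣p─q∣≤∣p∣ )
open import Data.List.Base as List using (List; []; _∷_)
import Data.List.Extrema.Nat as Extrema
open import Data.List.Membership.Propositional using () renaming (_∈_ to _∈ₗ_)
open import Data.List.Membership.Propositional.Properties
  using (∈-map⁺; ∈-map⁻; ∈-filter⁺; ∈-filter⁻; ∈-tabulate⁺; ∈-allFin)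
open import Data.List.Properties using (tabulate-cong)
import Data.List.Relation.Unary.All as All
open import Data.List.Relation.Unary.Any using (here; there)
open import Data.Nat.Base using (ℕ; suc; _+_; _*_; _∸_; _≤_; _<_; z≤n; s≤s)
open import Data.Nat.ListAction using (sum)
open import Data.Nat.Properties
  using ( ≤-trans; ≤-reflexive; ≤-antisym; ≤-refl; <⇒≱; <-irrefl; n≤1+n
        ; +-monoˡ-≤; m∸n+n≡m; +-cancelˡ-≤; *-suc; *-monoʳ-≤
        ; *-cancelˡ-≤; ∸-monoˡ-≤; m≤n+m∸n; m∸n≤m; module ≤-Reasoning )
open import Data.Product.Base using (_×_; _,_; proj₁; proj₂; Σ-syntax; ∃-syntax)
open import Data.Sum.Base as Sum using (_⊎_; inj₁; inj₂)
open import Data.Sum.Properties using (inj₁-injective; inj₂-injective)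
import Data.Vec.Base as Vec
open import Data.Vec.Base using ([]; _∷_; here; there)
open import Data.Vec.Properties as Vecₚ using ([]=⇒lookup; lookup⇒[]=; lookup∘tabulate)
open import Function.Base using (_∘_; _$_; id)
open import Function.Bundles using (_⇔_; _↔_; mk⇔; mk↔ₛ′; Inverse; Injection; Equivalence)
open import Function.Construct.Composition using (_↔-∘_)
open import Function.Construct.Symmetry using (↔-sym)
open import Function.Definitions using (Injective)
open import Function.Properties.Inverse using (↔⇒↣)
open import Level using (0ℓ)
open import Relation.Binary.PropositionalEquality
  using (_≡_; _≢_; refl; sym; trans; cong; subst; subst₂; _≗_; ≢-sym)
open import Relation.Nullary
  using (Dec; yes; no; does; contradiction; decidable-stable)
open import Relation.Nullary.Decidable using (dec-true)
open import Relation.Unary using (Pred) renaming (Decidable to Decidable₁)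

private
  variable
    m n k : ℕ

-- Minima of lists and sizes of finite subsets.

isInj₂? : {A B : Set} (x : A ⊎ B) → Dec (∃[ b ] x ≡ inj₂ b)
isInj₂? (inj₁ _) = no λ ()
isInj₂? (inj₂ b) = yes (b , refl)

minimum-≤ : ∀ {x xs} → x ∈ₗ xs → minimum xs ≤ x
minimum-≤ {xs = y ∷ ys} (here refl)  = Extrema.min≤⊤ y ys
minimum-≤ {xs = y ∷ ys} (there x∈ys) = All.lookup (Extrema.min≤xs y ys) x∈ys

-- The given member `x` rules out the empty list, where `minimum` has its junk value.
minimum-∈ : ∀ {x xs} → x ∈ₗ xs → minimum xs ∈ₗ xs
minimum-∈ {xs = y ∷ ys} _ with Extrema.argmin-sel id y ys
... | inj₁ min≡y  = here min≡y
... | inj₂ min∈ys = there min∈ys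

module _ {P : Pred (Fin n) 0ℓ} (P? : Decidable₁ P) where

  ∈-toSubset⁺ : ∀ {x} → P x → x ∈ toSubset P?
  ∈-toSubset⁺ {x} Px =
    lookup⇒[]= x _ (trans (lookup∘tabulate _ x) (dec-true (P? x) Px))

  ∈-toSubset⁻ : ∀ {x} → x ∈ toSubset P? → P x
  ∈-toSubset⁻ {x} x∈ with P? x | trans (sym (lookup∘tabulate (does ∘ P?) x)) ([]=⇒lookup x∈)
  ... | yes Px | _ = Px

0<∣p∣⇒Nonempty : {p : Subset n} → 0 < ∣ p ∣ → Nonempty p
0<∣p∣⇒Nonempty {n} {p} 0<∣p∣ with nonempty? p
... | yes ne = ne
... | no ¬ne = contradiction (trans (cong ∣_∣ (Empty-unique ¬ne)) (∣⊥∣≡0 n))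
                             (λ ∣p∣≡0 → <-irrefl (sym ∣p∣≡0) 0<∣p∣)

-- An element of `q` outside `p` would make the inclusion strict, hence also the inequality of
-- sizes. In the equality case this turns a count of neighbours into adjacency.
⊆∧∣∣≥⇒⊇ : {p q : Subset n} → p ⊆ q → ∣ q ∣ ≤ ∣ p ∣ → q ⊆ p
⊆∧∣∣≥⇒⊇ {p = p} p⊆q ∣q∣≤∣p∣ {x} x∈q = decidable-stable (x ∈? p) λ x∉p →
  <⇒≱ (p⊂q⇒∣p∣<∣q∣ (p⊆q , x , x∈q , x∉p)) ∣q∣≤∣p∣

∣p∣≤1+∣p-x∣ : (p : Subset n) (x : Fin n) → ∣ p ∣ ≤ suc ∣ p - x ∣
∣p∣≤1+∣p-x∣ (outside ∷ p) zero =
  ≤-trans (≤-reflexive (cong ∣_∣ (sym (p─⊥≡p p)))) (n≤1+n _)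
∣p∣≤1+∣p-x∣ (inside  ∷ p) zero = s≤s (≤-reflexive (cong ∣_∣ (sym (p─⊥≡p p))))
∣p∣≤1+∣p-x∣ (outside ∷ p) (suc x) = ∣p∣≤1+∣p-x∣ p x
∣p∣≤1+∣p-x∣ (inside  ∷ p) (suc x) = s≤s (∣p∣≤1+∣p-x∣ p x)

x∉p-x : (p : Subset n) (x : Fin n) → x ∉ p - x
x∉p-x (outside ∷ p) (suc x) (there x∈) = x∉p-x p x x∈
x∉p-x (inside  ∷ p) (suc x) (there x∈) = x∉p-x p x x∈

-- Splitting `Fin n` into a subset and its complement.

classify : (p : Subset n) → Fin n → Fin ∣ ∁ p ∣ ⊎ Fin ∣ p ∣
classify (outside ∷ p) zero    = inj₁ zero
classify (outside ∷ p) (suc x) = Sum.map₁ suc (classify p x)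
classify (inside  ∷ p) zero    = inj₂ zero
classify (inside  ∷ p) (suc x) = Sum.map₂ suc (classify p x)

unclassify : (p : Subset n) → Fin ∣ ∁ p ∣ ⊎ Fin ∣ p ∣ → Fin n
unclassify (outside ∷ p) (inj₁ zero)    = zero
unclassify (outside ∷ p) (inj₁ (suc i)) = suc (unclassify p (inj₁ i))
unclassify (outside ∷ p) (inj₂ j)       = suc (unclassify p (inj₂ j))
unclassify (inside  ∷ p) (inj₁ i)       = suc (unclassify p (inj₁ i))
unclassify (inside  ∷ p) (inj₂ zero)    = zero
unclassify (inside  ∷ p) (inj₂ (suc j)) = suc (unclassify p (inj₂ j))

unclassify-classify : (p : Subset n) → unclassify p ∘ classify p ≗ id
unclassify-classify (outside ∷ p) zero = refl
unclassify-classify (inside  ∷ p) zero = refl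
unclassify-classify (outside ∷ p) (suc x) with classify p x | unclassify-classify p x
... | inj₁ _ | eq = cong suc eq
... | inj₂ _ | eq = cong suc eq
unclassify-classify (inside ∷ p) (suc x) with classify p x | unclassify-classify p x
... | inj₁ _ | eq = cong suc eq
... | inj₂ _ | eq = cong suc eq

classify-unclassify : (p : Subset n) → classify p ∘ unclassify p ≗ id
classify-unclassify (outside ∷ p) (inj₁ zero)    = refl
classify-unclassify (outside ∷ p) (inj₁ (suc i)) = cong (Sum.map₁ suc) (classify-unclassify p (inj₁ i))
classify-unclassify (outside ∷ p) (inj₂ j)       = cong (Sum.map₁ suc) (classify-unclassify p (inj₂ j))
classify-unclassify (inside  ∷ p) (inj₁ i)       = cong (Sum.map₂ suc) (classify-unclassify p (inj₁ i))
classify-unclassify (inside  ∷ p) (inj₂ zero)    = refl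
classify-unclassify (inside  ∷ p) (inj₂ (suc j)) = cong (Sum.map₂ suc) (classify-unclassify p (inj₂ j))

-- The complement stands on the left to match `join`, whose right summand will be the complete
-- graph.
classify-↔ : (p : Subset n) → Fin n ↔ (Fin ∣ ∁ p ∣ ⊎ Fin ∣ p ∣)
classify-↔ p = mk↔ₛ′ (classify p) (unclassify p) (classify-unclassify p) (unclassify-classify p)

unclassify-inj₂∈ : (p : Subset n) (j : Fin ∣ p ∣) → unclassify p (inj₂ j) ∈ p
unclassify-inj₂∈ (outside ∷ p) j       = there (unclassify-inj₂∈ p j)
unclassify-inj₂∈ (inside  ∷ p) zero    = here
unclassify-inj₂∈ (inside  ∷ p) (suc j) = there (unclassify-inj₂∈ p j)

unclassify-inj₁∉ : (p : Subset n) (i : Fin ∣ ∁ p ∣) → unclassify p (inj₁ i) ∉ p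
unclassify-inj₁∉ (outside ∷ p) (suc i) (there x∈p) = unclassify-inj₁∉ p i x∈p
unclassify-inj₁∉ (inside  ∷ p) i       (there x∈p) = unclassify-inj₁∉ p i x∈p

rank : {p : Subset n} {x : Fin n} → x ∈ p → ∃[ j ] unclassify p (inj₂ j) ≡ x
rank {p = p} {x} x∈p with classify p x | unclassify-classify p x
... | inj₁ i | refl = contradiction x∈p (unclassify-inj₁∉ p i)
... | inj₂ j | eq   = j , eq

injective⇒≤∣p∣ : {p : Subset n} {g : Fin m → Fin n} → Injective _≡_ _≡_ g →
                 (∀ i → g i ∈ p) → m ≤ ∣ p ∣
injective⇒≤∣p∣ {p = p} g-inj g∈p = injective⇒≤ {f = λ i → proj₁ (rank (g∈p i))} λ {i} {j} eq →
  g-inj (trans (sym (proj₂ (rank (g∈p i))))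
        (trans (cong (unclassify p ∘ inj₂) eq) (proj₂ (rank (g∈p j)))))

↔⇒≤ : Fin m ↔ Fin n → m ≤ n
↔⇒≤ φ = injective⇒≤ (Injection.injective (↔⇒↣ φ))

-- Labellings and their weights.

weight-cong : {f g : Labelling n} → f ≗ g → weight f ≡ weight g
weight-cong f≗g = cong sum (tabulate-cong (cong toℕ ∘ f≗g))

V₂-cong : {f g : Labelling n} → f ≗ g → V₂ f ≡ V₂ g
V₂-cong f≗g = Vecₚ.tabulate-cong (λ v → cong (does ∘ (_≟ 2F)) (f≗g v))

2∣V₂∣≤weight : (f : Labelling n) → 2 * ∣ V₂ f ∣ ≤ weight f
2∣V₂∣≤weight {0}     f = z≤n
2∣V₂∣≤weight {suc n} f with f zero | 2∣V₂∣≤weight (f ∘ suc)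
... | 0F | ih = ih
... | 1F | ih = ≤-trans ih (n≤1+n _)
... | 2F | ih rewrite *-suc 2 ∣ V₂ (f ∘ suc) ∣ = s≤s (s≤s ih)

-- A label 1 adds to the weight but not to `V₂ f`. This excludes the label 1 in the equality case.
2∣V₂∣<weight : (f : Labelling n) (v : Fin n) → f v ≡ 1F → 2 * ∣ V₂ f ∣ < weight f
2∣V₂∣<weight f zero    fv≡1 rewrite fv≡1 = s≤s (2∣V₂∣≤weight (f ∘ suc))
2∣V₂∣<weight f (suc v) fv≡1 with f zero | 2∣V₂∣<weight (f ∘ suc) v fv≡1
... | 0F | ih = ih
... | 1F | ih = ≤-trans ih (n≤1+n _)
... | 2F | ih rewrite *-suc 2 ∣ V₂ (f ∘ suc) ∣ = s≤s (s≤s ih)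

twice : Subset n → Labelling n
twice p v = if Vec.lookup p v then 2F else 0F

twice≡0⇒∉ : {p : Subset n} {v : Fin n} → twice p v ≡ 0F → v ∉ p
twice≡0⇒∉ tv≡0 v∈p rewrite []=⇒lookup v∈p with () ← tv≡0

V₂-twice : (p : Subset n) → V₂ (twice p) ≡ p
V₂-twice []            = refl
V₂-twice (outside ∷ p) = cong (outside ∷_) (V₂-twice p)
V₂-twice (inside  ∷ p) = cong (inside ∷_) (V₂-twice p)

weight-twice : (p : Subset n) → weight (twice p) ≡ 2 * ∣ p ∣
weight-twice []            = refl
weight-twice (outside ∷ p) = weight-twice p
weight-twice (inside  ∷ p) =
  trans (cong (2 +_) (weight-twice p)) (sym (*-suc 2 ∣ p ∣))

-- Bounds on the Roman k-tuple domination number.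

module _ (G : Graph n) where
  open Graph G hiding (sym)

  δ≤degree : ∀ v → δ ≤ degree v
  δ≤degree v = minimum-≤ (∈-tabulate⁺ v)

  neighbors∩p⊆p-v : ∀ v (p : Subset n) → neighbors v ∩ p ⊆ p - v
  neighbors∩p⊆p-v v p w∈ with x∈p∩q⁻ (neighbors v) p w∈
  ... | w∈N , w∈p = x∈p∧x≢y⇒x∈p-y w∈p λ w≡v →
    irrefl (sym w≡v) (∈-toSubset⁻ (v ~?_) w∈N)

module _ (k : ℕ) (G : Graph n) where
  open Graph G hiding (sym)

  IsRkDF-cong : {f g : Labelling n} → f ≗ g → IsRkDF k G f → IsRkDF k G g
  IsRkDF-cong {f} {g} f≗g rkdf v with rkdf v
  ... | zeros , nonzeros rewrite f≗g v | V₂-cong f≗g = zeros , nonzeros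

  private
    weights : List ℕ
    weights = List.map weight (List.filter (isRkDF? k G) (allLabellings n))

    -- The enumeration contains `f` only up to pointwise equality, as `finToFun (funToFin f)`. The
    -- congruence lemmas carry the property over to that copy and its weight back to `f`.
    weight∈weights : {f : Labelling n} → IsRkDF k G f → weight f ∈ₗ weights
    weight∈weights {f} rkdf =
      subst (_∈ₗ weights) (weight-cong f′≗f) $
      ∈-map⁺ weight $
      ∈-filter⁺ (isRkDF? k G) (∈-map⁺ finToFun (∈-allFin (funToFin f)))
        (IsRkDF-cong (sym ∘ f′≗f) rkdf)
      where
      f′≗f : finToFun (funToFin f) ≗ f
      f′≗f = finToFun-funToFin f

  γ×R≤weight : {f : Labelling n} → IsRkDF k G f → γ×R k G ≤ weight f
  γ×R≤weight rkdf = minimum-≤ (weight∈weights rkdf)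

  -- Any RkDF `f` makes the list of weights nonempty, so its minimum is a member of it.
  γ×R-attained : {f : Labelling n} → IsRkDF k G f →
                 ∃[ g ] IsRkDF k G g × γ×R k G ≡ weight g
  γ×R-attained rkdf with ∈-map⁻ weight (minimum-∈ (weight∈weights rkdf))
  ... | g , g∈ , γ≡ = g , proj₂ (∈-filter⁻ (isRkDF? k G) {xs = allLabellings n} g∈) , γ≡

  twice-isRkDF : (p : Subset n) →
                 (∀ v → v ∉ p → k ≤ ∣ neighbors v ∩ p ∣) →
                 (∀ v → k ∸ 1 ≤ ∣ neighbors v ∩ p ∣) →
                 IsRkDF k G (twice p)
  twice-isRkDF p out all v rewrite V₂-twice p =
    (λ tv≡0 → out v (twice≡0⇒∉ tv≡0)) , (λ _ → all v)

  twice-⊤-isRkDF : k ∸ 1 ≤ δ → IsRkDF k G (twice ⊤)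
  twice-⊤-isRkDF k∸1≤δ = twice-isRkDF ⊤ (λ v v∉⊤ → contradiction ∈⊤ v∉⊤) λ v →
    subst (k ∸ 1 ≤_) (cong ∣_∣ (sym (∩-identityʳ (neighbors v))))
      (≤-trans k∸1≤δ (δ≤degree G v))

  γ×R≤2n : k ∸ 1 ≤ δ → γ×R k G ≤ 2 * n
  γ×R≤2n k∸1≤δ = begin
    γ×R k G              ≤⟨ γ×R≤weight (twice-⊤-isRkDF k∸1≤δ) ⟩
    weight (twice {n} ⊤) ≡⟨ weight-twice {n} ⊤ ⟩
    2 * ∣ ⊤ {n} ∣        ≡⟨ cong (2 *_) (∣⊤∣≡n n) ⟩
    2 * n                ∎
    where open ≤-Reasoning

  k∸1≤∣neighbors∩V₂∣ : {f : Labelling n} → IsRkDF k G f →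
                       ∀ v → k ∸ 1 ≤ ∣ neighbors v ∩ V₂ f ∣
  k∸1≤∣neighbors∩V₂∣ {f} rkdf v with f v ≟ 0F
  ... | yes fv≡0 = ≤-trans (m∸n≤m k 1) (proj₁ (rkdf v) fv≡0)
  ... | no  fv≢0 = proj₂ (rkdf v) fv≢0

  k≤∣V₂∣ : {f : Labelling n} → 2 ≤ k → Fin n → IsRkDF k G f → k ≤ ∣ V₂ f ∣
  k≤∣V₂∣ {f} 2≤k v rkdf
    -- As `2 ≤ k` makes `k ∸ 1` positive, `v` has a neighbour `w` in `V₂ f`. The count is then made
    -- at `w`, which lies in `V₂ f` but is not its own neighbour.
    with w , w∈ ← 0<∣p∣⇒Nonempty (≤-trans (∸-monoˡ-≤ 1 2≤k) (k∸1≤∣neighbors∩V₂∣ rkdf v))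
    = begin
    k                            ≤⟨ m≤n+m∸n k 1 ⟩
    suc (k ∸ 1)                  ≤⟨ s≤s (k∸1≤∣neighbors∩V₂∣ rkdf w) ⟩
    suc ∣ neighbors w ∩ V₂ f ∣   ≤⟨ s≤s (p⊆q⇒∣p∣≤∣q∣ (neighbors∩p⊆p-v G w (V₂ f))) ⟩
    suc ∣ V₂ f - w ∣             ≤⟨ x∈p⇒∣p-x∣<∣p∣ (proj₂ (x∈p∩q⁻ (neighbors v) (V₂ f) w∈)) ⟩
    ∣ V₂ f ∣                     ∎
    where open ≤-Reasoning

-- The equality case: cliques joined to every other vertex.

Universal : Graph n → Subset n → Set
Universal G p = ∀ {v w} → w ∈ p → w ≢ v → v G.~ w
  where module G = Graph G

module _ (G : Graph n) where
  open Graph G renaming (sym to ~-sym)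

  weight≡2k⇒universal : {f : Labelling n} → IsRkDF k G f → k ≤ ∣ V₂ f ∣ → weight f ≡ 2 * k →
                        k ≡ ∣ V₂ f ∣ × Universal G (V₂ f)
  weight≡2k⇒universal {k} {f} rkdf k≤ wf≡2k = k≡ , universal
    where
    k≡ : k ≡ ∣ V₂ f ∣
    k≡ = ≤-antisym k≤ (*-cancelˡ-≤ 2 (≤-trans (2∣V₂∣≤weight f) (≤-reflexive wf≡2k)))

    -- The reverse inclusion of sets is known from `neighbors∩p⊆p-v`, so this bound on sizes forces
    -- the two sets to coincide.
    ∣V₂-v∣≤ : ∀ v → ∣ V₂ f - v ∣ ≤ ∣ neighbors v ∩ V₂ f ∣
    ∣V₂-v∣≤ v with f v in fv≡
    ... | 0F = begin
      ∣ V₂ f - v ∣             ≤⟨ ∣p─q∣≤∣p∣ (V₂ f) _ ⟩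
      ∣ V₂ f ∣                 ≡⟨ sym k≡ ⟩
      k                        ≤⟨ proj₁ (rkdf v) fv≡ ⟩
      ∣ neighbors v ∩ V₂ f ∣   ∎
      where open ≤-Reasoning
    -- A vertex labelled 1 would push the weight above `2 * ∣ V₂ f ∣`, which is `2 * k`.
    ... | 1F = contradiction (2∣V₂∣<weight f v fv≡)
                 (<-irrefl (trans (cong (2 *_) (sym k≡)) (sym wf≡2k)))
    ... | 2F = begin
      ∣ V₂ f - v ∣             ≤⟨ ∸-monoˡ-≤ 1 (x∈p⇒∣p-x∣<∣p∣ (∈-toSubset⁺ (λ w → f w ≟ 2F) fv≡)) ⟩
      ∣ V₂ f ∣ ∸ 1             ≡⟨ cong (_∸ 1) (sym k≡) ⟩
      k ∸ 1                    ≤⟨ k∸1≤∣neighbors∩V₂∣ k G rkdf v ⟩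
      ∣ neighbors v ∩ V₂ f ∣   ∎
      where open ≤-Reasoning

    universal : Universal G (V₂ f)
    universal {v} w∈ w≢v = ∈-toSubset⁻ (v ~?_) $ proj₁ $ x∈p∩q⁻ (neighbors v) (V₂ f) $
      ⊆∧∣∣≥⇒⊇ (neighbors∩p⊆p-v G v (V₂ f)) (∣V₂-v∣≤ v) (x∈p∧x≢y⇒x∈p-y w∈ w≢v)

  twice-universal-isRkDF : {p : Subset n} → Universal G p → IsRkDF ∣ p ∣ G (twice p)
  twice-universal-isRkDF {p} universal = twice-isRkDF ∣ p ∣ G p
    (λ v v∉p → p⊆q⇒∣p∣≤∣q∣ λ {w} w∈p →
      w∈p⇒w∈N∩p w∈p λ { refl → v∉p w∈p })
    -- Whether or not `v` lies in `p`, removing it costs at most one element, and all that remain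
    -- are neighbours of `v`.
    (λ v → ≤-trans (∸-monoˡ-≤ 1 (∣p∣≤1+∣p-x∣ p v))
      (p⊆q⇒∣p∣≤∣q∣ λ w∈p-v →
        w∈p⇒w∈N∩p (p─q⊆p p _ w∈p-v) λ { refl → x∉p-x p v w∈p-v }))
    where
    w∈p⇒w∈N∩p : ∀ {v w} → w ∈ p → w ≢ v → w ∈ neighbors v ∩ p
    w∈p⇒w∈N∩p {v} w∈p w≢v = x∈p∩q⁺ (∈-toSubset⁺ (v ~?_) (universal w∈p w≢v) , w∈p)

  γ×R≤2∣universal∣ : {p : Subset n} → Universal G p → γ×R ∣ p ∣ G ≤ 2 * ∣ p ∣
  γ×R≤2∣universal∣ {p} universal =
    ≤-trans (γ×R≤weight ∣ p ∣ G (twice-universal-isRkDF universal)) (≤-reflexive (weight-twice p))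

  -- `H` is the subgraph induced on the complement of `p`, and each of its vertices is joined to the
  -- whole clique.
  universal⇒join : {p : Subset n} → Universal G p →
                   Σ[ m ∈ ℕ ] Σ[ H ∈ Graph m ] G ≅ H ∘[ ∣ p ∣ ] K ∣ p ∣
  universal⇒join {p} universal =
    ∣ ∁ p ∣ , H , ≤-refl , (λ _ → ⊤) , (λ _ → ≤-reflexive (sym (∣⊤∣≡n ∣ p ∣))) ,
    ↔-sym +↔⊎ ↔-∘ classify-↔ p , λ u v →
      -- The outer transport undoes `splitAt` in the adjacency of `join`. The inner one replaces the
      -- reconstructed vertices by `u` and `v`, which leaves a case analysis on the two sides.
      subst₂ (λ a b → u ~ v ⇔ JoinAdj H (K ∣ p ∣) (λ _ → ⊤) a b)
        (sym (splitAt-join _ _ (classify p u))) (sym (splitAt-join _ _ (classify p v)))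
        (subst₂ (λ x y → x ~ y ⇔ JoinAdj H (K ∣ p ∣) (λ _ → ⊤) (classify p u) (classify p v))
          (unclassify-classify p u) (unclassify-classify p v)
          (adjacency (classify p u) (classify p v)))
    where
    H : Graph ∣ ∁ p ∣
    H = record
      { _~_    = λ i j → unclassify p (inj₁ i) ~ unclassify p (inj₁ j)
      ; _~?_   = λ i j → unclassify p (inj₁ i) ~? unclassify p (inj₁ j)
      ; sym    = ~-sym
      ; irrefl = λ i≡j → irrefl (cong (unclassify p ∘ inj₁) i≡j)
      }

    unclassify-injective : Injective _≡_ _≡_ (unclassify p)
    unclassify-injective = Injection.injective (↔⇒↣ (↔-sym (classify-↔ p)))

    universal′ : ∀ a j → a ≢ inj₂ j → unclassify p a ~ unclassify p (inj₂ j)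
    universal′ a j a≢ = universal (unclassify-inj₂∈ p j) (≢-sym a≢ ∘ unclassify-injective)

    adjacency : ∀ a b → unclassify p a ~ unclassify p b ⇔ JoinAdj H (K ∣ p ∣) (λ _ → ⊤) a b
    adjacency (inj₁ i) (inj₁ j) = mk⇔ id id
    adjacency (inj₁ i) (inj₂ j) = mk⇔ (λ _ → ∈⊤) (λ _ → universal′ (inj₁ i) j λ ())
    adjacency (inj₂ i) (inj₁ j) = mk⇔ (λ _ → ∈⊤) (λ _ → ~-sym (universal′ (inj₁ j) i λ ()))
    adjacency (inj₂ i) (inj₂ j) =
      mk⇔ (λ i~j i≡j → irrefl (cong (unclassify p ∘ inj₂) i≡j) i~j)
          (λ i≢j → universal′ (inj₂ i) j λ { refl → i≢j refl })

  -- The set consists of the vertices that the isomorphism sends to the `K k` side.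
  join⇒universal : {H : Graph m} → G ≅ H ∘[ k ] K k →
                   Σ[ p ∈ Subset n ] ∣ p ∣ ≡ k × Universal G p
  join⇒universal {m} {k} {H} (_ , C , k≤∣C∣ , φ , ~⇔) =
    p , ≤-antisym ∣p∣≤k k≤∣p∣ , universal
    where
    ψ : Fin n ↔ (Fin m ⊎ Fin k)
    ψ = +↔⊎ ↔-∘ φ

    open Inverse ψ using (to; from; strictlyInverseˡ; strictlyInverseʳ)

    from-injective : Injective _≡_ _≡_ from
    from-injective = Injection.injective (↔⇒↣ (↔-sym ψ))

    p : Subset n
    p = toSubset (λ v → isInj₂? (to v))

    from-inj₂∈p : ∀ j → from (inj₂ j) ∈ p
    from-inj₂∈p j = ∈-toSubset⁺ (λ v → isInj₂? (to v)) (j , strictlyInverseˡ (inj₂ j))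

    from-inj₁∉p : ∀ i → from (inj₁ i) ∉ p
    from-inj₁∉p i ∈p with ∈-toSubset⁻ (λ v → isInj₂? (to v)) ∈p
    ... | j , eq with () ← trans (sym (strictlyInverseˡ (inj₁ i))) eq

    k≤∣p∣ : k ≤ ∣ p ∣
    k≤∣p∣ = injective⇒≤∣p∣ (inj₂-injective ∘ from-injective) from-inj₂∈p

    -- The complement of `p` has room for all `m` vertices of `H`. With `n ≤ m + k` this bounds `p`
    -- from above.
    m≤n∸∣p∣ : m ≤ n ∸ ∣ p ∣
    m≤n∸∣p∣ = subst (m ≤_) (∣∁p∣≡n∸∣p∣ p) $
      injective⇒≤∣p∣ (inj₁-injective ∘ from-injective) (x∉p⇒x∈∁p ∘ from-inj₁∉p)

    ∣p∣≤k : ∣ p ∣ ≤ k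
    ∣p∣≤k = +-cancelˡ-≤ m _ _ $ begin
      m + ∣ p ∣           ≤⟨ +-monoˡ-≤ ∣ p ∣ m≤n∸∣p∣ ⟩
      n ∸ ∣ p ∣ + ∣ p ∣   ≡⟨ m∸n+n≡m (∣p∣≤n p) ⟩
      n                   ≤⟨ ↔⇒≤ φ ⟩
      m + k               ∎
      where open ≤-Reasoning

    -- A subset of `Fin k` with at least `k` elements is everything, so a k-join to `K k` is a
    -- complete join.
    ∈C : ∀ i {j} → j ∈ C i
    ∈C i = subst (_ ∈_) (sym (∣p∣≡n⇒p≡⊤ (≤-antisym (∣p∣≤n (C i)) (k≤∣C∣ i)))) ∈⊤

    adjacent : ∀ {a b} → a ≢ b → ∃[ j ] b ≡ inj₂ j → JoinAdj H (K k) C a b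
    adjacent {inj₁ i} _   (_ , refl) = ∈C i
    adjacent {inj₂ i} a≢b (_ , refl) = a≢b ∘ cong inj₂

    universal : Universal G p
    universal {v} {w} w∈p w≢v = Equivalence.from (~⇔ v w) $
      adjacent (≢-sym w≢v ∘ Injection.injective (↔⇒↣ ψ))
               (∈-toSubset⁻ (λ v → isInj₂? (to v)) w∈p)

theorem1 : ∀ (k : ℕ) → 2 ≤ k →
    ∀ (n : ℕ) (G : Graph n) → k ∸ 1 ≤ Graph.δ G →
    (2 * k ≤ γ×R k G × γ×R k G ≤ 2 * n) ×
    (γ×R k G ≡ 2 * k ⇔
    (G ≅ K k ⊎ (Σ[ m ∈ ℕ ] Σ[ H ∈ Graph m ] G ≅ H ∘[ k ] K k)))
-- The graph without vertices has `δ` equal to 0 by default, whereas `k ∸ 1` is at least 1.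
theorem1 k 2≤k 0 G k∸1≤δ = contradiction (≤-trans (∸-monoˡ-≤ 1 2≤k) k∸1≤δ) λ ()
theorem1 k 2≤k n@(suc _) G k∸1≤δ
  -- `f` is an RkDF of minimum weight. The constant labelling 2 witnesses that one exists.
  with f , rkdf , γ≡weight ← γ×R-attained k G (twice-⊤-isRkDF k G k∸1≤δ) =
  (2k≤γ , γ≤2n) , mk⇔ structure (≤⇒≡ ∘ γ≤2k)
  where
  k≤∣V₂f∣ : k ≤ ∣ V₂ f ∣
  k≤∣V₂f∣ = k≤∣V₂∣ k G 2≤k zero rkdf

  2k≤γ : 2 * k ≤ γ×R k G
  2k≤γ = begin
    2 * k          ≤⟨ *-monoʳ-≤ 2 k≤∣V₂f∣ ⟩
    2 * ∣ V₂ f ∣   ≤⟨ 2∣V₂∣≤weight f ⟩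
    weight f       ≡⟨ γ≡weight ⟨
    γ×R k G        ∎
    where open ≤-Reasoning

  γ≤2n : γ×R k G ≤ 2 * n
  γ≤2n = γ×R≤2n k G k∸1≤δ

  ≤⇒≡ : γ×R k G ≤ 2 * k → γ×R k G ≡ 2 * k
  ≤⇒≡ γ≤2k = ≤-antisym γ≤2k 2k≤γ

  -- The graph H may be empty, so the join covers G = K k as well.
  structure : γ×R k G ≡ 2 * k →
              G ≅ K k ⊎ (Σ[ m ∈ ℕ ] Σ[ H ∈ Graph m ] G ≅ H ∘[ k ] K k)
  structure γ≡2k
    with k≡ , universal ← weight≡2k⇒universal G rkdf k≤∣V₂f∣ (trans (sym γ≡weight) γ≡2k) =
    inj₂ (subst (λ k → Σ[ m ∈ ℕ ] Σ[ H ∈ Graph m ] G ≅ H ∘[ k ] K k) (sym k≡)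
      (universal⇒join G universal))

  γ≤2k : G ≅ K k ⊎ (Σ[ m ∈ ℕ ] Σ[ H ∈ Graph m ] G ≅ H ∘[ k ] K k) → γ×R k G ≤ 2 * k
  -- The isomorphism gives `n ≤ k`, so the general upper bound suffices.
  γ≤2k (inj₁ (φ , _)) = ≤-trans γ≤2n (*-monoʳ-≤ 2 (↔⇒≤ φ))
  γ≤2k (inj₂ (_ , _ , isJoin)) with join⇒universal G isJoin
  ... | _ , refl , universal = γ×R≤2∣universal∣ G universal
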